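{- Let $\mathcal C$ be a cartesian $R$-differential category, where $R$ has multiplicative inverses for integers. For all $n,m\in\mathbb N$ and $r\in R$ the following equalities of families of morphisms hold: 1. $\tau_n\circ\iota_n=\iota^n$; 2. $\tau_n\circ\theta_n=\theta^n\circ(\tau_n*\tau_n)$; 3. $\tau_n\circ m_n(r)=m^n(r)\circ\tau_n$; 4. $(\tau_m*\tau_n)\circ c_{n,m}=c^{n,m}\circ(\tau_n*\tau_m)$, where $\tau_a*\tau_b:S_aS_bX\to S^aS^bX$ is the horizontal composite $S^a(\tau_b)\circ\tau_a$. The same equalities hold when $S_n,S^n$ are replaced by $T_n,T^n$ (that is, when $\tau_a*\tau_b$ is computed as $T^a(\tau_b)\circ\tau_a:T_aT_bX\to T^aT^bX$).
   Context: $R$ is a commutative semiring with multiplicative inverses for integers: for each integer $n\ge1$ there is $\frac1n\in R$ with $\frac1n\cdot(1_R+\cdots+1_R)=1_R$ ($n$ summands). A map between $R$-semimodules is $R$-additive if it preserves sums, $0$ and the action of $R$. A left $R$-additive category is a category $\mathcal C$ whose hom-sets are $R$-semimodules and such that every precomposition map $\_\circ f$ is $R$-additive; a morphism $h:Y\to Z$ is $R$-additive if every postcomposition map $h\circ\_:\mathcal C(X,Y)\to\mathcal C(X,Z)$ is $R$-additive. A cartesian left $R$-additive category is one with finite products whose projections are $R$-additive. $\langle\cdots\rangle$ denotes tupling. Put $SX=X\times X$, $Sf=f\times f$, with projections $\pi_0,\pi_1:SX\to X$. A derivative is a family of operators $D:\mathcal C(X,Y)\to\mathcal C(SX,Y)$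 such that: (i) $Dp=p\circ\pi_1$ for every product projection $p:X_0\times\cdots\times X_n\to X_i$; (ii) $D$ is $R$-additive; (iii) $D\,\mathrm{id}=\pi_1$ and $D(g\circ f)=Dg\circ\langle f\circ\pi_0,Df\rangle$; (iv) $Df$ is $R$-additive in its second argument, i.e. $u\mapsto Df\circ\langle x,u\rangle$ is $R$-additive; (v) $DDf\circ\langle\langle x,0\rangle,\langle 0,u\rangle\rangle=Df\circ\langle x,u\rangle$; (vi) $DDf\circ\langle\langle x,u\rangle,\langle v,w\rangle\rangle=DDf\circ\langle\langle x,v\rangle,\langle u,w\rangle\rangle$. A cartesian $R$-differential category is a cartesian left $R$-additive category with a derivative. The tangent functor is $TX=SX$, $Tf=\langle f\circ\pi_0,Df\rangle$; $T^n,S^n$ are $n$-fold iterates. $S_nX=X^{n+1}$, $S_nf=f^{n+1}$, with projections $\pi_0,\dots,\pi_n:S_nX\to X$; $s_{n\to m}=\langle\pi_0,\dots,\pi_m\rangle$ for $m\le n$. For $n\ge1$, $\nu_n=\langle\langle\pi_0,\dots,\pi_{n-1}\rangle,\langle\tfrac1n\pi_1,\dots,\tfrac nn\pi_n\rangle\rangle:S_nX\to SS_{n-1}X$. For $f:X\to Y$, $t_0f=f$, $t_{n+1}f=D(t_nf)\circ\nu_{n+1}$. The functor $T_n$ is $T_nX=S_nX$, $\pi_i\circ T_nf=t_if\circ s_{n\to i}$ ($0\le i\le n$). The family $\tau_n:S_nX\to S^nX$ is defined by $\tau_0=\mathrm{id}$ and $\tau_{n+1}=S(\tau_n)\circ\nu_{n+1}$.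 Families indexed by integers: $\iota_n:X\to S_nX$, $\theta_n:S_nS_nX\to S_nX$, $c_{n,m}:S_nS_mX\to S_mS_nX$, $m_n(r):S_nX\to S_nX$ are given by $\pi_k\circ\iota_n=\mathrm{id}$ if $k=0$ and $0$ otherwise; $\pi_k\circ\theta_n=\sum_{i+j=k}\pi_i\circ\pi_j$; $\pi_i\circ\pi_j\circ c_{n,m}=\pi_j\circ\pi_i$ ($i\le n$, $j\le m$); $\pi_k\circ m_n(r)=r^k\pi_k$. Families indexed by words: for $w=w_1\cdots w_n\in\{0,1\}^n$, $\pi_w=\pi_{w_1}\circ\cdots\circ\pi_{w_n}:S^nX\to X$, and $|w|$ is the number of $1$s in $w$. Then $\iota^n:X\to S^nX$, $\theta^n:S^nS^nX\to S^nX$, $c^{n,m}:S^nS^mX\to S^mS^nX$, $m^n(r):S^nX\to S^nX$ are given by $\pi_w\circ\iota^n=\mathrm{id}$ if $w=0\cdots0$ and $0$ otherwise; $\pi_w\circ\theta^n=\sum\pi_{w^1}\circ\pi_{w^2}$ over ordered pairs of words in $\{0,1\}^n$ with $w^1_i+w^2_i=w_i$ for all $i$; $\pi_u\circ\pi_v\circ c^{n,m}=\pi_v\circ\pi_u$ ($u\in\{0,1\}^n$, $v\in\{0,1\}^m$); $\pi_w\circ m^n(r)=r^{|w|}\pi_w$. (In composites of projections the right-most projects the outermost functor.) -}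

module Defs where

open import Level using (Level; _⊔_) renaming (suc to lsuc)
open import Algebra.Bundles using (CommutativeSemiring)
open import Algebra.Module.Bundles using (Semimodule)
open import Algebra.Module.Morphism.Structures using (module SemimoduleMorphisms)
import Algebra.Definitions.RawSemiring as RawSemiringDefinitions
open import Data.Nat.Base using (ℕ; zero; suc; NonZero; _+_)
import Data.Nat.Properties as ℕ
open import Data.Fin.Base using (Fin; zero; suc; toℕ; inject₁)
import Data.Fin.Properties as Fin
open import Data.List.Base using (List; []; _∷_; map; foldr; filter; allFin; cartesianProduct; cartesianProductWith)
open import Data.Vec.Base using (Vec; []; _∷_; replicate; zipWith; count)
import Data.Vec.Base as Vec
import Data.Vec.Properties as Vec
open import Data.Product.Base using (∃; _×_; _,_; proj₁)
open import Data.Bool.Base using (if_then_else_)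
open import Relation.Nullary.Decidable.Core using (does)

private
  variable
    c r o ℓ e m₁ ℓ₁ m₂ ℓ₂ : Level

module _ (R : CommutativeSemiring c r) where

  open CommutativeSemiring R
  open RawSemiringDefinitions rawSemiring using () renaming (_×_ to _·_)

  IntegerInverses : Set (c ⊔ r)
  IntegerInverses = ∀ n → .{{_ : NonZero n}} → ∃ λ q → q * (n · 1#) ≈ 1#

  fraction : IntegerInverses → ℕ → (n : ℕ) → .{{_ : NonZero n}} → Carrier
  fraction inv k n = (k · 1#) * proj₁ (inv n)

IsAdditive : {R : CommutativeSemiring c r} (M : Semimodule R m₁ ℓ₁) (N : Semimodule R m₂ ℓ₂) →
             (Semimodule.Carrierᴹ M → Semimodule.Carrierᴹ N) → Set (c ⊔ m₁ ⊔ ℓ₁ ⊔ ℓ₂)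
IsAdditive M N = IsSemimoduleHomomorphism
  where open SemimoduleMorphisms (Semimodule.rawSemimodule M) (Semimodule.rawSemimodule N)

-- The equality of morphisms is that of the hom-semimodules.

record LeftAdditiveCategory (R : CommutativeSemiring c r) (o ℓ e : Level) :
                            Set (c ⊔ r ⊔ lsuc (o ⊔ ℓ ⊔ e)) where
  infix  4 _⇒_ _≈_
  infixl 6 _⊕_
  infixr 7 _⊙_
  infixr 9 _∘_

  field
    Obj : Set o
    Hom : Obj → Obj → Semimodule R ℓ e

  _⇒_ : Obj → Obj → Set ℓ
  X ⇒ Y = Semimodule.Carrierᴹ (Hom X Y)

  _≈_ : ∀ {X Y} → X ⇒ Y → X ⇒ Y → Set e
  _≈_ {X} {Y} = Semimodule._≈ᴹ_ (Hom X Y)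

  ≈-refl : ∀ {X Y} {f : X ⇒ Y} → f ≈ f
  ≈-refl {X} {Y} = Semimodule.≈ᴹ-refl (Hom X Y)

  ≈-trans : ∀ {X Y} {f g h : X ⇒ Y} → f ≈ g → g ≈ h → f ≈ h
  ≈-trans {X} {Y} = Semimodule.≈ᴹ-trans (Hom X Y)

  _⊕_ : ∀ {X Y} → X ⇒ Y → X ⇒ Y → X ⇒ Y
  _⊕_ {X} {Y} = Semimodule._+ᴹ_ (Hom X Y)

  𝟘 : ∀ {X Y} → X ⇒ Y
  𝟘 {X} {Y} = Semimodule.0ᴹ (Hom X Y)

  _⊙_ : ∀ {X Y} → CommutativeSemiring.Carrier R → X ⇒ Y → X ⇒ Y
  _⊙_ {X} {Y} = Semimodule._*ₗ_ (Hom X Y)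

  field
    id  : ∀ {X} → X ⇒ X
    _∘_ : ∀ {X Y Z} → Y ⇒ Z → X ⇒ Y → X ⇒ Z

    assoc     : ∀ {W X Y Z} {f : W ⇒ X} {g : X ⇒ Y} {h : Y ⇒ Z} → (h ∘ g) ∘ f ≈ h ∘ (g ∘ f)
    identityˡ : ∀ {X Y} {f : X ⇒ Y} → id ∘ f ≈ f
    identityʳ : ∀ {X Y} {f : X ⇒ Y} → f ∘ id ≈ f
    ∘-resp-≈  : ∀ {X Y Z} {g g′ : Y ⇒ Z} {f f′ : X ⇒ Y} → g ≈ g′ → f ≈ f′ → g ∘ f ≈ g′ ∘ f′

    precomposition-additive : ∀ {X Y} (f : X ⇒ Y) Z → IsAdditive (Hom Y Z) (Hom X Z) (_∘ f)

  AdditiveMorphism : ∀ {Y Z} → Y ⇒ Z → Set (c ⊔ o ⊔ ℓ ⊔ e)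
  AdditiveMorphism {Y} {Z} h = ∀ X → IsAdditive (Hom X Y) (Hom X Z) (h ∘_)

  ∑ : ∀ {X Y} → List (X ⇒ Y) → X ⇒ Y
  ∑ = foldr _⊕_ 𝟘

record FiniteProducts {R : CommutativeSemiring c r} (C : LeftAdditiveCategory R o ℓ e) :
                      Set (o ⊔ ℓ ⊔ e) where
  open LeftAdditiveCategory C

  infixr 8 _⊗_

  field
    ⊤        : Obj
    !        : ∀ {X} → X ⇒ ⊤
    !-unique : ∀ {X} (f : X ⇒ ⊤) → ! ≈ f

    _⊗_      : Obj → Obj → Obj
    π₀       : ∀ {X Y} → X ⊗ Y ⇒ X
    π₁       : ∀ {X Y} → X ⊗ Y ⇒ Y
    ⟨_,_⟩    : ∀ {A X Y} → A ⇒ X → A ⇒ Y → A ⇒ X ⊗ Y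
    project₀ : ∀ {A X Y} {f : A ⇒ X} {g : A ⇒ Y} → π₀ ∘ ⟨ f , g ⟩ ≈ f
    project₁ : ∀ {A X Y} {f : A ⇒ X} {g : A ⇒ Y} → π₁ ∘ ⟨ f , g ⟩ ≈ g
    ⟨⟩-unique : ∀ {A X Y} {h : A ⇒ X ⊗ Y} {f : A ⇒ X} {g : A ⇒ Y} →
                π₀ ∘ h ≈ f → π₁ ∘ h ≈ g → ⟨ f , g ⟩ ≈ h

  -- ∏ F is F₀ × ⋯ × Fₙ, with n + 1 factors; for n = 0 it is F₀ itself.

  ∏ : ∀ {n} → (Fin (suc n) → Obj) → Obj
  ∏ {zero}  F = F zero
  ∏ {suc n} F = F zero ⊗ ∏ (λ i → F (suc i))

  proj : ∀ {n} (F : Fin (suc n) → Obj) (i : Fin (suc n)) → ∏ F ⇒ F i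
  proj {zero}  F zero    = id
  proj {suc n} F zero    = π₀
  proj {suc n} F (suc i) = proj (λ j → F (suc j)) i ∘ π₁

  tuple : ∀ {n} (F : Fin (suc n) → Obj) {A} → (∀ i → A ⇒ F i) → A ⇒ ∏ F
  tuple {zero}  F f = f zero
  tuple {suc n} F f = ⟨ f zero , tuple (λ i → F (suc i)) (λ i → f (suc i)) ⟩

  S : Obj → Obj
  S X = X ⊗ X

  mapS : ∀ {X Y} → X ⇒ Y → S X ⇒ S Y
  mapS f = ⟨ f ∘ π₀ , f ∘ π₁ ⟩

record CartesianLeftAdditiveCategory (R : CommutativeSemiring c r) (o ℓ e : Level) :
                                     Set (c ⊔ r ⊔ lsuc (o ⊔ ℓ ⊔ e)) where
  field
    leftAdditiveCategory : LeftAdditiveCategory R o ℓ e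
    finiteProducts       : FiniteProducts leftAdditiveCategory

  open LeftAdditiveCategory leftAdditiveCategory public
  open FiniteProducts finiteProducts public

  field
    proj-additive : ∀ {n} (F : Fin (suc n) → Obj) i → AdditiveMorphism (proj F i)

record CartesianDifferentialCategory (R : CommutativeSemiring c r) (o ℓ e : Level) :
                                     Set (c ⊔ r ⊔ lsuc (o ⊔ ℓ ⊔ e)) where
  field
    cartesianLeftAdditiveCategory : CartesianLeftAdditiveCategory R o ℓ e

  open CartesianLeftAdditiveCategory cartesianLeftAdditiveCategory public

  field
    D : ∀ {X Y} → X ⇒ Y → S X ⇒ Y

    D-proj      : ∀ {n} (F : Fin (suc n) → Obj) i → D (proj F i) ≈ proj F i ∘ π₁
    D-additive  : ∀ X Y → IsAdditive (Hom X Y) (Hom (S X) Y) D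
    D-id        : ∀ {X} → D (id {X}) ≈ π₁
    D-∘         : ∀ {X Y Z} (g : Y ⇒ Z) (f : X ⇒ Y) → D (g ∘ f) ≈ D g ∘ ⟨ f ∘ π₀ , D f ⟩
    D-additive₂ : ∀ {A X Y} (f : X ⇒ Y) (x : A ⇒ X) →
                  IsAdditive (Hom A X) (Hom A Y) (λ u → D f ∘ ⟨ x , u ⟩)
    DD-linear   : ∀ {A X Y} (f : X ⇒ Y) (x u : A ⇒ X) →
                  D (D f) ∘ ⟨ ⟨ x , 𝟘 ⟩ , ⟨ 𝟘 , u ⟩ ⟩ ≈ D f ∘ ⟨ x , u ⟩
    DD-symmetric : ∀ {A X Y} (f : X ⇒ Y) (x u v w : A ⇒ X) →
                  D (D f) ∘ ⟨ ⟨ x , u ⟩ , ⟨ v , w ⟩ ⟩ ≈ D (D f) ∘ ⟨ ⟨ x , v ⟩ , ⟨ u , w ⟩ ⟩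

  mapT : ∀ {X Y} → X ⇒ Y → S X ⇒ S Y
  mapT f = ⟨ f ∘ π₀ , D f ⟩

-- The letters of w = w₁⋯wₙ are stored as wₙ ∷ ⋯ ∷ w₁ ∷ []: the head of the
-- vector is the letter acting on the outermost copy of S in Sⁿ⁺¹ X = S (Sⁿ X).

Word : ℕ → Set
Word n = Vec (Fin 2) n

allWords : ∀ n → List (Word n)
allWords zero    = [] ∷ []
allWords (suc n) = cartesianProductWith _∷_ (allFin 2) (allWords n)

∣_∣₁ : ∀ {n} → Word n → ℕ
∣ w ∣₁ = count (Fin._≟ suc zero) w

indexSplittings : ∀ {n} → Fin (suc n) → List (Fin (suc n) × Fin (suc n))
indexSplittings {n} k =
  filter (λ (i , j) → toℕ i + toℕ j ℕ.≟ toℕ k)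
         (cartesianProduct (allFin (suc n)) (allFin (suc n)))

-- The letters are added as natural numbers, so 1 + 1 matches no letter.

wordSplittings : ∀ {n} → Word n → List (Word n × Word n)
wordSplittings {n} w =
  filter (λ (u , v) → Vec.≡-dec ℕ._≟_ (zipWith _+_ (Vec.map toℕ u) (Vec.map toℕ v)) (Vec.map toℕ w))
         (cartesianProduct (allWords n) (allWords n))

-- Lower indices (Sₙ, ιₙ, …) mark the families indexed by integers, upper ones
-- (Sⁿ, ιⁿ, …) those indexed by words.

module Families {R : CommutativeSemiring c r} (C : CartesianLeftAdditiveCategory R o ℓ e) where

  open CartesianLeftAdditiveCategory C
  open CommutativeSemiring R using (Carrier; rawSemiring)
  open RawSemiringDefinitions rawSemiring using (_^_)

  Sₙ : ℕ → Obj → Obj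
  Sₙ n X = ∏ {n} (λ _ → X)

  π : ∀ {n X} → Fin (suc n) → Sₙ n X ⇒ X
  π {n} {X} = proj {n} (λ _ → X)

  tupleₙ : ∀ {n X A} → (Fin (suc n) → A ⇒ X) → A ⇒ Sₙ n X
  tupleₙ {n} {X} = tuple {n} (λ _ → X)

  π-tupleₙ : ∀ {n X A} (f : Fin (suc n) → A ⇒ X) i → π {n} {X} i ∘ tupleₙ {n} {X} f ≈ f i
  π-tupleₙ {zero}  f zero = identityˡ
  π-tupleₙ {suc n} f zero = project₀
  π-tupleₙ {suc n} {X} {A} f (suc i) = ≈-trans assoc (≈-trans (∘-resp-≈ ≈-refl project₁) (π-tupleₙ {n} (λ j → f (suc j)) i))

  Sⁿ : ℕ → Obj → Obj
  Sⁿ zero    X = X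
  Sⁿ (suc n) X = S (Sⁿ n X)

  πʷ : ∀ {n X} → Word n → Sⁿ n X ⇒ X
  πʷ []             = id
  πʷ (zero     ∷ w) = πʷ w ∘ π₀
  πʷ (suc zero ∷ w) = πʷ w ∘ π₁

  tupleʷ : ∀ {n X A} → (Word n → A ⇒ X) → A ⇒ Sⁿ n X
  tupleʷ {zero}  f = f []
  tupleʷ {suc n} f = ⟨ tupleʷ (λ w → f (zero ∷ w)) , tupleʷ (λ w → f (suc zero ∷ w)) ⟩

  π-tupleʷ : ∀ {n X A} (f : Word n → A ⇒ X) w → πʷ w ∘ tupleʷ f ≈ f w
  π-tupleʷ f []             = identityˡ
  π-tupleʷ f (zero     ∷ w) = ≈-trans assoc (≈-trans (∘-resp-≈ ≈-refl project₀) (π-tupleʷ (λ v → f (zero ∷ v)) w))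
  π-tupleʷ f (suc zero ∷ w) = ≈-trans assoc (≈-trans (∘-resp-≈ ≈-refl project₁) (π-tupleʷ (λ v → f (suc zero ∷ v)) w))

  mapSⁿ : ∀ n {X Y} → X ⇒ Y → Sⁿ n X ⇒ Sⁿ n Y
  mapSⁿ zero    f = f
  mapSⁿ (suc n) f = mapS (mapSⁿ n f)

  ιₙ : ∀ n X → X ⇒ Sₙ n X
  ιₙ n X = tupleₙ {n} λ where
    zero    → id
    (suc _) → 𝟘

  θₙ : ∀ n X → Sₙ n (Sₙ n X) ⇒ Sₙ n X
  θₙ n X = tupleₙ {n} λ k → ∑ (map (λ (i , j) → π {n} i ∘ π {n} j) (indexSplittings k))

  cₙ : ∀ n m X → Sₙ n (Sₙ m X) ⇒ Sₙ m (Sₙ n X)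
  cₙ n m X = tupleₙ {m} λ j → tupleₙ {n} λ i → π {m} j ∘ π {n} i

  mₙ : ∀ n → Carrier → ∀ X → Sₙ n X ⇒ Sₙ n X
  mₙ n r X = tupleₙ {n} λ k → (r ^ toℕ k) ⊙ π {n} k

  ιⁿ : ∀ n X → X ⇒ Sⁿ n X
  ιⁿ n X = tupleʷ {n} λ w → if does (Vec.≡-dec Fin._≟_ w (replicate n zero)) then id else 𝟘

  θⁿ : ∀ n X → Sⁿ n (Sⁿ n X) ⇒ Sⁿ n X
  θⁿ n X = tupleʷ {n} λ w → ∑ (map (λ (u , v) → πʷ u ∘ πʷ v) (wordSplittings w))

  cⁿ : ∀ n m X → Sⁿ n (Sⁿ m X) ⇒ Sⁿ m (Sⁿ n X)
  cⁿ n m X = tupleʷ {m} λ v → tupleʷ {n} λ u → πʷ v ∘ πʷ u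

  mⁿ : ∀ n → Carrier → ∀ X → Sⁿ n X ⇒ Sⁿ n X
  mⁿ n r X = tupleʷ {n} λ w → (r ^ ∣ w ∣₁) ⊙ πʷ w

  module Comparison (inv : IntegerInverses R) where

    -- ν n is νₙ₊₁ : Sₙ₊₁ X → S (Sₙ X).

    ν : ∀ n X → Sₙ (suc n) X ⇒ S (Sₙ n X)
    ν n X = ⟨ tupleₙ {n} (λ i → π {suc n} (inject₁ i))
            , tupleₙ {n} (λ i → fraction R inv (toℕ (suc i)) (suc n) ⊙ π {suc n} (suc i)) ⟩

    τ : ∀ n X → Sₙ n X ⇒ Sⁿ n X
    τ zero    X = id
    τ (suc n) X = mapS (τ n X) ∘ ν n X

    τ⋆τ : ∀ a b X → Sₙ a (Sₙ b X) ⇒ Sⁿ a (Sⁿ b X)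
    τ⋆τ a b X = mapSⁿ a (τ b X) ∘ τ a (Sₙ b X)

module DifferentialFamilies {R : CommutativeSemiring c r} (C : CartesianDifferentialCategory R o ℓ e) where

  open CartesianDifferentialCategory C
  open Families cartesianLeftAdditiveCategory public

  -- T and S agree on objects, so Tⁿ X is Sⁿ X.

  mapTⁿ : ∀ n {X Y} → X ⇒ Y → Sⁿ n X ⇒ Sⁿ n Y
  mapTⁿ zero    f = f
  mapTⁿ (suc n) f = mapT (mapTⁿ n f)

  module TangentComparison (inv : IntegerInverses R) where

    open Comparison inv public

    τ⋆τᵀ : ∀ a b X → Sₙ a (Sₙ b X) ⇒ Sⁿ a (Sⁿ b X)
    τ⋆τᵀ a b X = mapTⁿ a (τ b X) ∘ τ a (Sₙ b X)

{-# OPTIONS --safe #-}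
module Submission where

-- Every component of τ is a multiple of a projection: π_w ∘ τₙ = α(w) π_|w|, where α(0w) = α(w) and
-- α(1w) = α(w)(|w| + 1)/(n + 1) for w of length n, the first letter being that of the outermost S (the
-- last one in the usual order of words). Comparing components, equations 1, 3 and 4 are
-- immediate, and equation 2 becomes
--
--   ∑_{u + v = w, |u| = i, |v| = j} α(u) α(v) = α(w)   whenever i + j = |w|.
--
-- By induction on w: the splittings of 1w that put the 1 in u, respectively in v, contribute
-- i/(n + 1) α(w), respectively j/(n + 1) α(w), and these add up to α(1w). For the version with Tⁿ,
-- τ is built from projections and scalars, so D τ = τ ∘ π₁ and Tⁿ τ = Sⁿ τ.

open import Defs
open import Level using (Level)
open import Algebra.Bundles using (CommutativeMonoid; CommutativeSemiring)
open import Algebra.Module.Bundles using (Semimodule)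
open import Algebra.Module.Morphism.Structures using (module SemimoduleMorphisms)
import Algebra.Definitions.RawSemiring as RawSemiringDefinitions
import Algebra.Properties.CommutativeSemigroup as CommutativeSemigroupProperties
import Algebra.Properties.Monoid.Mult as MonoidMult
open import Data.Bool.Base using (if_then_else_; true; false)
open import Data.Fin.Base using (Fin; zero; suc; toℕ; inject₁)
import Data.Fin.Properties as Fin
open import Data.List.Base using (List; []; _∷_; _++_; map; foldr; filter; allFin;
  cartesianProduct; cartesianProductWith)
import Data.List.Properties as List
open import Data.Nat.Base using (ℕ; zero; suc; _+_; _<_; s≤s)
import Data.Nat.Properties as ℕ
open import Data.Product.Base using (_×_; _,_; uncurry)
open import Data.Vec.Base using ([]; _∷_; replicate; zipWith)
import Data.Vec.Base as Vec
import Data.Vec.Properties as Vec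
open import Relation.Binary.PropositionalEquality.Core as ≡ using (_≡_)
import Relation.Binary.Reasoning.Setoid as SetoidReasoning
open import Relation.Nullary.Decidable.Core using (does)
open import Relation.Unary using (Decidable)

private
  variable
    a b p c r o ℓ e : Level
    n : ℕ

-- Finite sums in a commutative monoid: lists, antidiagonals, splittings of words.

module ListSums (M : CommutativeMonoid c ℓ) where

  open CommutativeMonoid M
  open SetoidReasoning setoid

  private
    variable
      A B E : Set a

  sum : (A → Carrier) → List A → Carrier
  sum f xs = foldr _∙_ ε (map f xs)

  sum-cong : ∀ {f g : A → Carrier} → (∀ x → f x ≈ g x) → ∀ xs → sum f xs ≈ sum g xs
  sum-cong f≈g []       = refl
  sum-cong f≈g (x ∷ xs) = ∙-cong (f≈g x) (sum-cong f≈g xs)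

  sum-ε : ∀ (xs : List A) → sum (λ _ → ε) xs ≈ ε
  sum-ε []       = refl
  sum-ε (x ∷ xs) = trans (identityˡ _) (sum-ε xs)

  sum-map : ∀ (f : B → Carrier) (g : A → B) xs → sum f (map g xs) ≡ sum (λ x → f (g x)) xs
  sum-map f g xs = ≡.cong (foldr _∙_ ε) (≡.sym (List.map-∘ xs))

  sum-++ : ∀ (f : A → Carrier) xs ys → sum f (xs ++ ys) ≈ sum f xs ∙ sum f ys
  sum-++ f []       ys = sym (identityˡ _)
  sum-++ f (x ∷ xs) ys = trans (∙-congˡ (sum-++ f xs ys)) (sym (assoc _ _ _))

  sum-filter : ∀ {P : A → Set p} (P? : Decidable P) (f : A → Carrier) xs →
               sum f (filter P? xs) ≈ sum (λ x → if does (P? x) then f x else ε) xs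
  sum-filter P? f []       = refl
  sum-filter P? f (x ∷ xs) with does (P? x)
  ... | true  = ∙-congˡ (sum-filter P? f xs)
  ... | false = trans (sum-filter P? f xs) (sym (identityˡ _))

  sum-cartesianProductWith : ∀ (f : E → Carrier) (g : A → B → E) xs ys →
    sum f (cartesianProductWith g xs ys) ≈ sum (λ x → sum (λ y → f (g x y)) ys) xs
  sum-cartesianProductWith f g []       ys = refl
  sum-cartesianProductWith f g (x ∷ xs) ys = trans (sum-++ f (map (g x) ys) _)
    (∙-cong (reflexive (sum-map f (g x) ys)) (sum-cartesianProductWith f g xs ys))

  -- `allFin` is a tabulation, so its tail is `tabulate suc` and not a mapped list; both sides are
  -- brought to the tabulation of `f (suc i)`.
  sum-allFin-suc : ∀ n (f : Fin (suc n) → Carrier) →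
                   sum f (allFin (suc n)) ≡ f zero ∙ sum (λ i → f (suc i)) (allFin n)
  sum-allFin-suc n f = ≡.cong (λ xs → f zero ∙ foldr _∙_ ε xs)
    (≡.trans (List.map-tabulate suc f) (≡.sym (List.map-tabulate (λ i → i) (λ i → f (suc i)))))

  sum-allWords-suc : ∀ (f : Word (suc n) → Carrier) →
    sum f (allWords (suc n)) ≈
    sum (λ w → f (zero ∷ w)) (allWords n) ∙ sum (λ w → f (suc zero ∷ w)) (allWords n)
  sum-allWords-suc {n} f = trans (sum-cartesianProductWith f _∷_ (allFin 2) (allWords n))
    -- The outer sum over the two letters ends in `ε`.
    (∙-congˡ (identityʳ _))

  -- The indices are natural numbers, without bounds, so that the recursive call can simply shift
  -- the first one.
  antidiagonal : ℕ → (ℕ → ℕ → Carrier) → Carrier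
  antidiagonal zero    g = g 0 0
  antidiagonal (suc k) g = g 0 (suc k) ∙ antidiagonal k (λ i j → g (suc i) j)

  antidiagonal-cong : ∀ k {f g : ℕ → ℕ → Carrier} → (∀ i j → i + j ≡ k → f i j ≈ g i j) →
                      antidiagonal k f ≈ antidiagonal k g
  antidiagonal-cong zero    f≈g = f≈g 0 0 ≡.refl
  antidiagonal-cong (suc k) f≈g = ∙-cong (f≈g 0 (suc k) ≡.refl)
    (antidiagonal-cong k (λ i j eq → f≈g (suc i) j (≡.cong suc eq)))

  antidiagonal-∙ : ∀ k (f g : ℕ → ℕ → Carrier) →
    antidiagonal k (λ i j → f i j ∙ g i j) ≈ antidiagonal k f ∙ antidiagonal k g
  antidiagonal-∙ zero    f g = refl
  antidiagonal-∙ (suc k) f g = trans (∙-congˡ (antidiagonal-∙ k _ _)) (interchange _ _ _ _)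
    where open CommutativeSemigroupProperties commutativeSemigroup using (interchange)

  -- The recursion of `antidiagonal` splits off the end `i = 0`; the symmetric argument in
  -- `antidiagonal-fraction` also needs the end `j = 0`.
  antidiagonal-sucʳ : ∀ k (g : ℕ → ℕ → Carrier) →
    antidiagonal (suc k) g ≈ antidiagonal k (λ i j → g i (suc j)) ∙ g (suc k) 0
  antidiagonal-sucʳ zero    g = refl
  antidiagonal-sucʳ (suc k) g = trans (∙-congˡ (antidiagonal-sucʳ k (λ i j → g (suc i) j))) (sym (assoc _ _ _))

  sum-allFin-point : ∀ {k N} → k < N → (g : ℕ → Carrier) →
    sum {A = Fin N} (λ j → if does (toℕ j ℕ.≟ k) then g (toℕ j) else ε) (allFin N) ≈ g k
  -- The test computes: it is true at index 0 and false at every successor, so the tail is literally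
  -- a sum of `ε`. In the other case the two successors cancel in the test.
  sum-allFin-point {zero} {suc N} (s≤s _) g = begin
    _                                 ≡⟨ sum-allFin-suc N _ ⟩
    g 0 ∙ sum (λ _ → ε) (allFin N)    ≈⟨ ∙-congˡ (sum-ε (allFin N)) ⟩
    g 0 ∙ ε                           ≈⟨ identityʳ _ ⟩
    g 0                               ∎
  sum-allFin-point {suc k} {suc N} (s≤s k<N) g = begin
    _            ≡⟨ sum-allFin-suc N _ ⟩
    ε ∙ _        ≈⟨ identityˡ _ ⟩
    _            ≈⟨ sum-allFin-point k<N (λ j → g (suc j)) ⟩
    g (suc k)    ∎

  -- Row `i = 0` meets the antidiagonal in one point, and the remaining rows form the same sum for
  -- `k - 1` with `g` shifted. Only the number of rows drops, hence the separate bounds `M` and `N`.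
  sum-allFin-antidiagonal : ∀ {k M N} → k < M → k < N → (g : ℕ → ℕ → Carrier) →
    sum {A = Fin M} (λ i → sum {A = Fin N}
      (λ j → if does (toℕ i + toℕ j ℕ.≟ k) then g (toℕ i) (toℕ j) else ε) (allFin N)) (allFin M)
    ≈ antidiagonal k g
  sum-allFin-antidiagonal {zero} {suc M} {N} (s≤s _) k<N g = begin
    _            ≡⟨ sum-allFin-suc M _ ⟩
    _            ≈⟨ ∙-cong (sum-allFin-point k<N (g 0)) (sum-cong (λ _ → sum-ε (allFin N)) (allFin M)) ⟩
    g 0 0 ∙ sum (λ _ → ε) (allFin M)    ≈⟨ ∙-congˡ (sum-ε (allFin M)) ⟩
    g 0 0 ∙ ε                           ≈⟨ identityʳ _ ⟩
    g 0 0                               ∎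
  sum-allFin-antidiagonal {suc k} {suc M} {N} (s≤s k<M) k<N g = begin
    _            ≡⟨ sum-allFin-suc M _ ⟩
    _            ≈⟨ ∙-cong (sum-allFin-point k<N (g 0))
                           (sum-allFin-antidiagonal k<M (ℕ.<-trans (ℕ.n<1+n k) k<N) (λ i → g (suc i))) ⟩
    antidiagonal (suc k) g ∎

  -- Both entries of a pair with sum `k` are at most `k`, hence at most `n`, so no pair of the
  -- antidiagonal is lost by working in `Fin (suc n)`.
  sum-indexSplittings : ∀ (k : Fin (suc n)) (g : ℕ → ℕ → Carrier) →
    sum (λ (i , j) → g (toℕ i) (toℕ j)) (indexSplittings k) ≈ antidiagonal (toℕ k) g
  sum-indexSplittings {n} k g = trans
    (sum-filter (λ (i , j) → toℕ i + toℕ j ℕ.≟ toℕ k) (λ (i , j) → g (toℕ i) (toℕ j))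
                (cartesianProduct (allFin (suc n)) (allFin (suc n))))
    (trans (sum-cartesianProductWith _ _,_ (allFin (suc n)) (allFin (suc n)))
           (sum-allFin-antidiagonal (Fin.toℕ<n k) (Fin.toℕ<n k) g))

  -- The sum over `wordSplittings`, organised letter by letter: 0 splits only as 0 + 0, and 1 as 0 +
  -- 1 or 1 + 0. This form admits induction on the word.
  wordConvolution : Word n → (Word n → Word n → Carrier) → Carrier
  wordConvolution []             f = f [] []
  wordConvolution (zero     ∷ w) f = wordConvolution w (λ u v → f (zero ∷ u) (zero ∷ v))
  wordConvolution (suc zero ∷ w) f = wordConvolution w (λ u v → f (zero ∷ u) (suc zero ∷ v))
                                   ∙ wordConvolution w (λ u v → f (suc zero ∷ u) (zero ∷ v))

  wordConvolution-cong : ∀ (w : Word n) {f g : Word n → Word n → Carrier} →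
    (∀ u v → f u v ≈ g u v) → wordConvolution w f ≈ wordConvolution w g
  wordConvolution-cong []             f≈g = f≈g [] []
  wordConvolution-cong (zero     ∷ w) f≈g = wordConvolution-cong w (λ u v → f≈g _ _)
  wordConvolution-cong (suc zero ∷ w) f≈g =
    ∙-cong (wordConvolution-cong w (λ u v → f≈g _ _)) (wordConvolution-cong w (λ u v → f≈g _ _))

  -- The equality test on vectors computes on the heads: a wrong pair of first letters makes it
  -- false, leaving a sum of `ε`, and a right pair leaves the test on the tails.
  sum-allWords-convolution : ∀ (w : Word n) (f : Word n → Word n → Carrier) →
    sum (λ u → sum (λ v →
      if does (Vec.≡-dec ℕ._≟_ (zipWith _+_ (Vec.map toℕ u) (Vec.map toℕ v)) (Vec.map toℕ w))
      then f u v else ε) (allWords n)) (allWords n)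
    ≈ wordConvolution w f
  sum-allWords-convolution [] f = trans (identityʳ _) (identityʳ _)
  sum-allWords-convolution {suc n} (zero ∷ w) f = begin
    _ ≈⟨ sum-allWords-suc {n} _ ⟩
    _ ≈⟨ ∙-cong
           -- First letter 0 in `u`: only 0 in `v` survives. First letter 1 in `u`: the sum of the
           -- letters is 1 or 2, so nothing survives.
           (sum-cong (λ u → trans (sum-allWords-suc {n} _)
             (trans (∙-congˡ (sum-ε (allWords n))) (identityʳ _))) (allWords n))
           (sum-cong (λ u → trans (sum-allWords-suc {n} _)
             (trans (∙-cong (sum-ε (allWords n)) (sum-ε (allWords n))) (identityʳ _))) (allWords n)) ⟩
    _ ≈⟨ ∙-cong (sum-allWords-convolution w _) (sum-ε (allWords n)) ⟩
    _ ≈⟨ identityʳ _ ⟩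
    wordConvolution (zero ∷ w) f ∎
  sum-allWords-convolution {suc n} (suc zero ∷ w) f = begin
    _ ≈⟨ sum-allWords-suc {n} _ ⟩
    _ ≈⟨ ∙-cong
           -- Here 0 in `u` forces 1 in `v`, and 1 in `u` forces 0 in `v`, because 1 + 1 = 2 differs
           -- from 1.
           (sum-cong (λ u → trans (sum-allWords-suc {n} _)
             (trans (∙-congʳ (sum-ε (allWords n))) (identityˡ _))) (allWords n))
           (sum-cong (λ u → trans (sum-allWords-suc {n} _)
             (trans (∙-congˡ (sum-ε (allWords n))) (identityʳ _))) (allWords n)) ⟩
    _ ≈⟨ ∙-cong (sum-allWords-convolution w _) (sum-allWords-convolution w _) ⟩
    wordConvolution (suc zero ∷ w) f ∎

  sum-wordSplittings : ∀ (w : Word n) (f : Word n → Word n → Carrier) →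
    sum (uncurry f) (wordSplittings w) ≈ wordConvolution w f
  sum-wordSplittings {n} w f = trans
    (sum-filter (λ (u , v) → Vec.≡-dec ℕ._≟_ (zipWith _+_ (Vec.map toℕ u) (Vec.map toℕ v)) (Vec.map toℕ w))
                (uncurry f) (cartesianProduct (allWords n) (allWords n)))
    (trans (sum-cartesianProductWith _ _,_ (allWords n) (allWords n)) (sum-allWords-convolution w f))

-- The coefficients of the comparison and their convolution identity.

module Weights (R : CommutativeSemiring c r) (inv : IntegerInverses R) where

  open CommutativeSemiring R hiding (zero) renaming (_+_ to _+ᴿ_)
  open RawSemiringDefinitions rawSemiring using () renaming (_×_ to _·_)
  open MonoidMult +-monoid using (×-homo-+)

  -- The coefficient α of the overview. Explicitly it is the factorial of the number of ones divided
  -- by the product of their positions, counted from 1 at the innermost copy of `S`.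
  weight : Word n → Carrier
  weight []                     = 1#
  weight (zero ∷ w)             = weight w
  weight {suc n} (suc zero ∷ w) = weight w * fraction R inv (suc ∣ w ∣₁) (suc n)

  fraction-zero : ∀ n → fraction R inv 0 (suc n) ≈ 0#
  fraction-zero n = zeroˡ _

  fraction-+ : ∀ i j n → fraction R inv (i + j) (suc n) ≈
               fraction R inv i (suc n) +ᴿ fraction R inv j (suc n)
  fraction-+ i j n = trans (*-congʳ (×-homo-+ 1# i j)) (distribʳ _ _ _)

  module _ {m e} (M : Semimodule R m e) where

    open Semimodule M
    open ListSums +ᴹ-commutativeMonoid
    open SetoidReasoning ≈ᴹ-setoid
    open CommutativeSemigroupProperties *-commutativeSemigroup using (xy∙z≈xz∙y)

    antidiagonal-*ₗ : ∀ k s (g : ℕ → ℕ → Carrierᴹ) →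
      antidiagonal k (λ i j → s *ₗ g i j) ≈ᴹ s *ₗ antidiagonal k g
    antidiagonal-*ₗ zero    s g = ≈ᴹ-refl
    antidiagonal-*ₗ (suc k) s g =
      ≈ᴹ-trans (+ᴹ-congˡ (antidiagonal-*ₗ k s _)) (≈ᴹ-sym (*ₗ-distribˡ s _ _))

    -- On i + j = k + 1 the factors i/(n+1) and j/(n+1) add up to (k+1)/(n+1); the terms with factor 0
    -- are those missing from the two sums on the left.
    antidiagonal-fraction : ∀ n k (g : ℕ → ℕ → Carrierᴹ) → let φ = λ i → fraction R inv i (suc n) in
      antidiagonal k (λ i j → φ (suc j) *ₗ g i (suc j)) +ᴹ antidiagonal k (λ i j → φ (suc i) *ₗ g (suc i) j)
      ≈ᴹ φ (suc k) *ₗ antidiagonal (suc k) g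
    antidiagonal-fraction n k g = begin
      antidiagonal k (λ i j → φ (suc j) *ₗ g i (suc j)) +ᴹ antidiagonal k (λ i j → φ (suc i) *ₗ g (suc i) j)
        ≈⟨ +ᴹ-cong (+ᴹ-identityʳ _) (+ᴹ-identityˡ _) ⟨
      (antidiagonal k (λ i j → φ (suc j) *ₗ g i (suc j)) +ᴹ 0ᴹ)
        +ᴹ (0ᴹ +ᴹ antidiagonal k (λ i j → φ (suc i) *ₗ g (suc i) j))
        ≈⟨ +ᴹ-cong (+ᴹ-congˡ (φ0 _)) (+ᴹ-congʳ (φ0 _)) ⟨
      (antidiagonal k (λ i j → φ (suc j) *ₗ g i (suc j)) +ᴹ φ 0 *ₗ g (suc k) 0)
        +ᴹ antidiagonal (suc k) (λ i j → φ i *ₗ g i j)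
        ≈⟨ +ᴹ-congʳ (antidiagonal-sucʳ k (λ i j → φ j *ₗ g i j)) ⟨
      antidiagonal (suc k) (λ i j → φ j *ₗ g i j) +ᴹ antidiagonal (suc k) (λ i j → φ i *ₗ g i j)
        ≈⟨ antidiagonal-∙ (suc k) (λ i j → φ j *ₗ g i j) (λ i j → φ i *ₗ g i j) ⟨
      antidiagonal (suc k) (λ i j → φ j *ₗ g i j +ᴹ φ i *ₗ g i j)
        ≈⟨ antidiagonal-cong (suc k) (λ i j eq → φ-sum i j eq) ⟩
      antidiagonal (suc k) (λ i j → φ (suc k) *ₗ g i j)
        ≈⟨ antidiagonal-*ₗ (suc k) _ g ⟩
      φ (suc k) *ₗ antidiagonal (suc k) g ∎
      where
      φ : ℕ → Carrier
      φ i = fraction R inv i (suc n)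

      φ0 : ∀ x → φ 0 *ₗ x ≈ᴹ 0ᴹ
      φ0 x = ≈ᴹ-trans (*ₗ-congʳ (fraction-zero n)) (*ₗ-zeroˡ x)

      φ-sum : ∀ i j → i + j ≡ suc k → φ j *ₗ g i j +ᴹ φ i *ₗ g i j ≈ᴹ φ (suc k) *ₗ g i j
      φ-sum i j i+j≡1+k = begin
        φ j *ₗ g i j +ᴹ φ i *ₗ g i j  ≈⟨ *ₗ-distribʳ _ _ _ ⟨
        (φ j +ᴿ φ i) *ₗ g i j         ≈⟨ *ₗ-congʳ (+-comm _ _) ⟩
        (φ i +ᴿ φ j) *ₗ g i j         ≈⟨ *ₗ-congʳ (fraction-+ i j n) ⟨
        φ (i + j) *ₗ g i j            ≡⟨ ≡.cong (λ l → φ l *ₗ g i j) i+j≡1+k ⟩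
        φ (suc k) *ₗ g i j            ∎

    -- The identity for α with all pairs (i, j) treated at once. Leaving `g` arbitrary makes the
    -- induction work: a letter 1 is absorbed into `g` as a shift of one index and a fraction, and
    -- `antidiagonal-fraction` recombines the two cases.
    wordConvolution-weight : ∀ (w : Word n) (g : ℕ → ℕ → Carrierᴹ) →
      wordConvolution w (λ u v → (weight u * weight v) *ₗ g ∣ u ∣₁ ∣ v ∣₁)
      ≈ᴹ weight w *ₗ antidiagonal ∣ w ∣₁ g
    wordConvolution-weight []         g = *ₗ-congʳ (*-identityˡ 1#)
    wordConvolution-weight (zero ∷ w) g = wordConvolution-weight w g
    wordConvolution-weight {suc n} (suc zero ∷ w) g = begin
      _ ≈⟨ +ᴹ-cong
             -- The fraction contributed by the letter 1, first in `v` and then in `u`, moves out of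
             -- the product of weights and onto `g`.
             (wordConvolution-cong w (λ u v → ≈ᴹ-trans (*ₗ-congʳ (sym (*-assoc _ _ _))) (*ₗ-assoc _ _ _)))
             (wordConvolution-cong w (λ u v → ≈ᴹ-trans (*ₗ-congʳ (xy∙z≈xz∙y _ _ _)) (*ₗ-assoc _ _ _))) ⟩
      _ ≈⟨ +ᴹ-cong (wordConvolution-weight w (λ i j → φ (suc j) *ₗ g i (suc j)))
                   (wordConvolution-weight w (λ i j → φ (suc i) *ₗ g (suc i) j)) ⟩
      _ ≈⟨ *ₗ-distribˡ (weight w) _ _ ⟨
      _ ≈⟨ *ₗ-congˡ (antidiagonal-fraction n ∣ w ∣₁ g) ⟩
      _ ≈⟨ *ₗ-assoc _ _ _ ⟨
      weight (suc zero ∷ w) *ₗ antidiagonal (suc ∣ w ∣₁) g ∎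
      where
      φ : ℕ → Carrier
      φ i = fraction R inv i (suc n)

-- Additive maps and finite sums.

module AdditiveMaps {R : CommutativeSemiring c r} {M : Semimodule R a ℓ} {N : Semimodule R b e}
                    {h : Semimodule.Carrierᴹ M → Semimodule.Carrierᴹ N} (h-additive : IsAdditive M N h) where

  open SemimoduleMorphisms (Semimodule.rawSemimodule M) (Semimodule.rawSemimodule N)
  open IsSemimoduleHomomorphism h-additive public using (⟦⟧-cong; *ₗ-homo; +ᴹ-homo; 0ᴹ-homo)

  open Semimodule N
  private
    module M = ListSums (Semimodule.+ᴹ-commutativeMonoid M)
    module N = ListSums (Semimodule.+ᴹ-commutativeMonoid N)

  sum-homo : ∀ {A : Set p} (f : A → Semimodule.Carrierᴹ M) xs →
             h (M.sum f xs) ≈ᴹ N.sum (λ x → h (f x)) xs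
  sum-homo f []       = 0ᴹ-homo
  sum-homo f (x ∷ xs) = ≈ᴹ-trans (+ᴹ-homo _ _) (+ᴹ-congˡ (sum-homo f xs))

-- Projections, components and the comparison in a cartesian left additive category.

module CartesianLeftAdditive {R : CommutativeSemiring c r} (C : CartesianLeftAdditiveCategory R o ℓ e) where

  open CartesianLeftAdditiveCategory C
  open Families C
  open CommutativeSemiring R using (Carrier; _*_; rawSemiring)
  open RawSemiringDefinitions rawSemiring using (_^_)
  open module HomSemimodule {X Y} = Semimodule (Hom X Y) using (≈ᴹ-sym; *ₗ-assoc; *ₗ-cong)
  open module HomReasoning {X Y} = SetoidReasoning (Semimodule.≈ᴹ-setoid (Hom X Y))
  open module HomSums {X Y} = ListSums (Semimodule.+ᴹ-commutativeMonoid (Hom X Y))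
    using (sum; sum-cong; antidiagonal; sum-indexSplittings; wordConvolution; wordConvolution-cong; sum-wordSplittings)
  open module Precomposition {X Y} (f : X ⇒ Y) {Z} = AdditiveMaps {M = Hom _ _} {N = Hom _ _} (precomposition-additive f Z)
    using () renaming (*ₗ-homo to ⊙-∘; sum-homo to sum-∘)

  private
    variable
      A X Y Z : Obj

  open module Postcomposition {Y Z} {h : Y ⇒ Z} (h-additive : AdditiveMorphism h) {X} = AdditiveMaps {M = Hom X Y} {N = Hom X Z} (h-additive X)
    using () renaming (*ₗ-homo to ∘-⊙)

  ∘-congˡ : {f : Y ⇒ Z} {g h : X ⇒ Y} → g ≈ h → f ∘ g ≈ f ∘ h
  ∘-congˡ = ∘-resp-≈ ≈-refl

  ∘-congʳ : {f g : Y ⇒ Z} {h : X ⇒ Y} → f ≈ g → f ∘ h ≈ g ∘ h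
  ∘-congʳ f≈g = ∘-resp-≈ f≈g ≈-refl

  ⊙-congˡ : ∀ {s} {f g : X ⇒ Y} → f ≈ g → s ⊙ f ≈ s ⊙ g
  ⊙-congˡ = *ₗ-cong (CommutativeSemiring.refl R)

  ⟨⟩-cong : {f f′ : A ⇒ X} {g g′ : A ⇒ Y} → f ≈ f′ → g ≈ g′ → ⟨ f , g ⟩ ≈ ⟨ f′ , g′ ⟩
  ⟨⟩-cong f≈f′ g≈g′ = ⟨⟩-unique (≈-trans project₀ (≈ᴹ-sym f≈f′)) (≈-trans project₁ (≈ᴹ-sym g≈g′))

  ⟨⟩-ext : {f g : A ⇒ X ⊗ Y} → π₀ ∘ f ≈ π₀ ∘ g → π₁ ∘ f ≈ π₁ ∘ g → f ≈ g
  ⟨⟩-ext π₀f≈π₀g π₁f≈π₁g = ≈-trans (≈ᴹ-sym (⟨⟩-unique π₀f≈π₀g π₁f≈π₁g)) (⟨⟩-unique ≈-refl ≈-refl)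

  πʷ-ext : ∀ n {f g : A ⇒ Sⁿ n X} → (∀ (w : Word n) → πʷ {n} {X} w ∘ f ≈ πʷ w ∘ g) → f ≈ g
  πʷ-ext zero    eq = ≈-trans (≈ᴹ-sym identityˡ) (≈-trans (eq []) identityˡ)
  πʷ-ext (suc n) eq = ⟨⟩-ext
    (πʷ-ext n (λ w → ≈-trans (≈ᴹ-sym assoc) (≈-trans (eq (zero ∷ w)) assoc)))
    (πʷ-ext n (λ w → ≈-trans (≈ᴹ-sym assoc) (≈-trans (eq (suc zero ∷ w)) assoc)))

  πʷ-mapSⁿ : ∀ (w : Word n) (f : X ⇒ Y) → πʷ w ∘ mapSⁿ n f ≈ f ∘ πʷ w
  πʷ-mapSⁿ []             f = ≈-trans identityˡ (≈ᴹ-sym identityʳ)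
  πʷ-mapSⁿ {suc n} (zero ∷ w) f = begin
    (πʷ w ∘ π₀) ∘ mapSⁿ (suc n) f ≈⟨ assoc ⟩
    πʷ w ∘ (π₀ ∘ mapSⁿ (suc n) f) ≈⟨ ∘-congˡ project₀ ⟩
    πʷ w ∘ (mapSⁿ n f ∘ π₀)       ≈⟨ assoc ⟨
    (πʷ w ∘ mapSⁿ n f) ∘ π₀       ≈⟨ ∘-congʳ (πʷ-mapSⁿ w f) ⟩
    (f ∘ πʷ w) ∘ π₀               ≈⟨ assoc ⟩
    f ∘ πʷ (zero ∷ w)             ∎
  πʷ-mapSⁿ {suc n} (suc zero ∷ w) f = begin
    (πʷ w ∘ π₁) ∘ mapSⁿ (suc n) f ≈⟨ assoc ⟩
    πʷ w ∘ (π₁ ∘ mapSⁿ (suc n) f) ≈⟨ ∘-congˡ project₁ ⟩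
    πʷ w ∘ (mapSⁿ n f ∘ π₁)       ≈⟨ assoc ⟨
    (πʷ w ∘ mapSⁿ n f) ∘ π₁       ≈⟨ ∘-congʳ (πʷ-mapSⁿ w f) ⟩
    (f ∘ πʷ w) ∘ π₁               ≈⟨ assoc ⟩
    f ∘ πʷ (suc zero ∷ w)         ∎

  -- Indexing by all of ℕ, with the junk value 0 above n, turns the composites πᵢ ∘ πⱼ into a function
  -- of two natural numbers, to which the sums over antidiagonals apply.

  πᴺ : ∀ n {X} → ℕ → Sₙ n X ⇒ X
  πᴺ zero    zero    = id
  πᴺ zero    (suc k) = 𝟘
  πᴺ (suc n) zero    = π₀
  πᴺ (suc n) (suc k) = πᴺ n k ∘ π₁

  π-toℕ : ∀ {n} (i : Fin (suc n)) → π {n} {X} i ≡ πᴺ n (toℕ i)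
  π-toℕ {n = zero}  zero    = ≡.refl
  π-toℕ {n = suc n} zero    = ≡.refl
  π-toℕ {n = suc n} (suc i) = ≡.cong (_∘ π₁) (π-toℕ {n = n} i)

  -- The number of ones as a projection index. The clauses use `inject₁` and `suc`, the two
  -- reindexings in `ν`, so the induction for `πʷ-τ` needs no cast between indices.
  ones : Word n → Fin (suc n)
  ones []             = zero
  ones (zero ∷ w)     = inject₁ (ones w)
  ones (suc zero ∷ w) = suc (ones w)

  toℕ-ones : ∀ (w : Word n) → toℕ (ones w) ≡ ∣ w ∣₁
  toℕ-ones []             = ≡.refl
  toℕ-ones (zero ∷ w)     = ≡.trans (Fin.toℕ-inject₁ (ones w)) (toℕ-ones w)
  toℕ-ones (suc zero ∷ w) = ≡.cong suc (toℕ-ones w)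

  module Comparisons (inv : IntegerInverses R) where

    open Comparison inv
    open Weights R inv

    -- The first letter selects a half of `ν`, which `mapS` carries past `τ`; the induction
    -- hypothesis then leaves one component of that half, with scalar 1 for letter 0 and a fraction
    -- for letter 1.
    πʷ-τ : ∀ (w : Word n) → πʷ w ∘ τ n X ≈ weight w ⊙ π {n} {X} (ones w)
    πʷ-τ {X = X} [] = ≈-trans identityˡ (≈ᴹ-sym (Semimodule.*ₗ-identityˡ (Hom X X) id))
    πʷ-τ {suc n} {X} (zero ∷ w) = begin
      (πʷ w ∘ π₀) ∘ (mapS (τ n X) ∘ ν n X)  ≈⟨ assoc ⟩
      πʷ w ∘ (π₀ ∘ (mapS (τ n X) ∘ ν n X))  ≈⟨ ∘-congˡ (≈-trans (≈ᴹ-sym assoc) (≈-trans (∘-congʳ project₀) assoc)) ⟩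
      πʷ w ∘ (τ n X ∘ (π₀ ∘ ν n X))         ≈⟨ ∘-congˡ (∘-congˡ project₀) ⟩
      πʷ w ∘ (τ n X ∘ _)                    ≈⟨ assoc ⟨
      (πʷ w ∘ τ n X) ∘ _                    ≈⟨ ∘-congʳ (πʷ-τ w) ⟩
      (weight w ⊙ π {n} (ones w)) ∘ _       ≈⟨ ⊙-∘ _ _ _ ⟩
      weight w ⊙ (π {n} (ones w) ∘ _)       ≈⟨ ⊙-congˡ (π-tupleₙ {n} _ (ones w)) ⟩
      weight w ⊙ π {suc n} (inject₁ (ones w)) ∎
    πʷ-τ {suc n} {X} (suc zero ∷ w) = begin
      (πʷ w ∘ π₁) ∘ (mapS (τ n X) ∘ ν n X)  ≈⟨ assoc ⟩
      πʷ w ∘ (π₁ ∘ (mapS (τ n X) ∘ ν n X))  ≈⟨ ∘-congˡ (≈-trans (≈ᴹ-sym assoc) (≈-trans (∘-congʳ project₁) assoc)) ⟩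
      πʷ w ∘ (τ n X ∘ (π₁ ∘ ν n X))         ≈⟨ ∘-congˡ (∘-congˡ project₁) ⟩
      πʷ w ∘ (τ n X ∘ _)                    ≈⟨ assoc ⟨
      (πʷ w ∘ τ n X) ∘ _                    ≈⟨ ∘-congʳ (πʷ-τ w) ⟩
      (weight w ⊙ π {n} (ones w)) ∘ _       ≈⟨ ⊙-∘ _ _ _ ⟩
      weight w ⊙ (π {n} (ones w) ∘ _)       ≈⟨ ⊙-congˡ (π-tupleₙ {n} _ (ones w)) ⟩
      weight w ⊙ (φ (suc (toℕ (ones w))) ⊙ π {suc n} (suc (ones w)))
        ≡⟨ ≡.cong (λ k → weight w ⊙ (φ (suc k) ⊙ π {suc n} (suc (ones w)))) (toℕ-ones w) ⟩
      weight w ⊙ (φ (suc ∣ w ∣₁) ⊙ π {suc n} (suc (ones w))) ≈⟨ *ₗ-assoc _ _ _ ⟨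
      weight (suc zero ∷ w) ⊙ π {suc n} (suc (ones w)) ∎
      where
      φ : ℕ → Carrier
      φ k = fraction R inv k (suc n)

    πʷ-τ-∘ : ∀ (w : Word n) (f : A ⇒ Sₙ n X) → πʷ w ∘ (τ n X ∘ f) ≈ weight w ⊙ (π {n} (ones w) ∘ f)
    πʷ-τ-∘ w f = ≈-trans (≈ᴹ-sym assoc) (≈-trans (∘-congʳ (πʷ-τ w)) (⊙-∘ f _ _))

    -- The outer scalar comes out because precomposition is additive, the inner one because
    -- projections are additive morphisms.
    ⊙π-∘-⊙π : ∀ {n m} s t (i : Fin (suc n)) (j : Fin (suc m)) →
      (s ⊙ π {n} {X} i) ∘ (t ⊙ π {m} j) ≈ (s * t) ⊙ (π {n} i ∘ π {m} j)
    ⊙π-∘-⊙π {n = n} {m} s t i j = begin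
      (s ⊙ π {n} i) ∘ (t ⊙ π {m} j)   ≈⟨ ⊙-∘ _ _ _ ⟩
      s ⊙ (π {n} i ∘ (t ⊙ π {m} j))   ≈⟨ ⊙-congˡ (∘-⊙ (proj-additive (λ _ → _) i) _ _) ⟩
      s ⊙ (t ⊙ (π {n} i ∘ π {m} j))   ≈⟨ *ₗ-assoc _ _ _ ⟨
      (s * t) ⊙ (π {n} i ∘ π {m} j)   ∎

    -- By naturality `πʷ v` passes `mapSⁿ`, so that each projection meets its own `τ`.
    πʷ-πʷ-τ⋆τ : ∀ {n m} (u : Word n) (v : Word m) →
      (πʷ u ∘ πʷ v) ∘ τ⋆τ m n X ≈ (weight u * weight v) ⊙ (π {n} (ones u) ∘ π {m} (ones v))
    πʷ-πʷ-τ⋆τ {X = X} {n} {m} u v = begin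
      (πʷ u ∘ πʷ v) ∘ (mapSⁿ m (τ n X) ∘ τ m (Sₙ n X)) ≈⟨ assoc ⟩
      πʷ u ∘ (πʷ v ∘ (mapSⁿ m (τ n X) ∘ τ m (Sₙ n X))) ≈⟨ ∘-congˡ (≈-trans (≈ᴹ-sym assoc) (≈-trans (∘-congʳ (πʷ-mapSⁿ v (τ n X))) assoc)) ⟩
      πʷ u ∘ (τ n X ∘ (πʷ v ∘ τ m (Sₙ n X)))           ≈⟨ assoc ⟨
      (πʷ u ∘ τ n X) ∘ (πʷ v ∘ τ m (Sₙ n X))           ≈⟨ ∘-resp-≈ (πʷ-τ u) (πʷ-τ v) ⟩
      (weight u ⊙ π {n} (ones u)) ∘ (weight v ⊙ π {m} (ones v)) ≈⟨ ⊙π-∘-⊙π _ _ (ones u) (ones v) ⟩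
      (weight u * weight v) ⊙ (π {n} (ones u) ∘ π {m} (ones v)) ∎

    π-zero-ιₙ : ∀ n → π {n} zero ∘ ιₙ n X ≈ id
    π-zero-ιₙ n = π-tupleₙ {n} _ zero

    π-suc-ιₙ : ∀ n (i : Fin n) → π {n} (suc i) ∘ ιₙ n X ≈ 𝟘
    π-suc-ιₙ n i = π-tupleₙ {n} _ (suc i)

    π-inject₁-ιₙ : ∀ {n} (i : Fin (suc n)) → π {suc n} (inject₁ i) ∘ ιₙ (suc n) X ≈ π {n} i ∘ ιₙ n X
    π-inject₁-ιₙ {n = n} zero    = ≈-trans (π-zero-ιₙ (suc n)) (≈ᴹ-sym (π-zero-ιₙ n))
    π-inject₁-ιₙ {n = n} (suc i) = ≈-trans (π-suc-ιₙ (suc n) (inject₁ i)) (≈ᴹ-sym (π-suc-ιₙ n i))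

    weight-π-ιₙ : ∀ (w : Word n) → weight w ⊙ (π {n} (ones w) ∘ ιₙ n X)
                  ≈ (if does (Vec.≡-dec Fin._≟_ w (replicate n zero)) then id else 𝟘)
    weight-π-ιₙ {X = X} []       = ≈-trans (Semimodule.*ₗ-identityˡ (Hom X X) _) identityˡ
    weight-π-ιₙ (zero ∷ w)       = ≈-trans (⊙-congˡ (π-inject₁-ιₙ (ones w))) (weight-π-ιₙ w)
    -- A letter 1 makes the index a successor, where `ιₙ` is 0 whatever the weight; the word without
    -- ones has weight 1.
    weight-π-ιₙ {suc n} {X} (suc zero ∷ w) =
      ≈-trans (⊙-congˡ (π-suc-ιₙ (suc n) (ones w))) (Semimodule.*ₗ-zeroʳ (Hom X X) _)

    τ-ι : ∀ n X → τ n X ∘ ιₙ n X ≈ ιⁿ n X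
    τ-ι n X = πʷ-ext n λ w → begin
      πʷ w ∘ (τ n X ∘ ιₙ n X)                ≈⟨ πʷ-τ-∘ w (ιₙ n X) ⟩
      weight w ⊙ (π {n} (ones w) ∘ ιₙ n X)   ≈⟨ weight-π-ιₙ w ⟩
      _                                      ≈⟨ π-tupleʷ {n} _ w ⟨
      πʷ w ∘ ιⁿ n X                          ∎

    τ-m : ∀ n ρ X → τ n X ∘ mₙ n ρ X ≈ mⁿ n ρ X ∘ τ n X
    τ-m n ρ X = πʷ-ext n λ w → begin
      πʷ w ∘ (τ n X ∘ mₙ n ρ X)                             ≈⟨ πʷ-τ-∘ w (mₙ n ρ X) ⟩
      weight w ⊙ (π {n} (ones w) ∘ mₙ n ρ X)                ≈⟨ ⊙-congˡ (π-tupleₙ {n} _ (ones w)) ⟩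
      weight w ⊙ ((ρ ^ toℕ (ones w)) ⊙ π {n} (ones w))
        ≡⟨ ≡.cong (λ k → weight w ⊙ ((ρ ^ k) ⊙ π {n} (ones w))) (toℕ-ones w) ⟩
      weight w ⊙ ((ρ ^ ∣ w ∣₁) ⊙ π {n} (ones w))            ≈⟨ Semimodule.*ₗ-comm (Hom _ X) _ _ _ ⟩
      (ρ ^ ∣ w ∣₁) ⊙ (weight w ⊙ π {n} (ones w))            ≈⟨ ⊙-congˡ (πʷ-τ w) ⟨
      (ρ ^ ∣ w ∣₁) ⊙ (πʷ w ∘ τ n X)                         ≈⟨ ⊙-∘ _ _ _ ⟨
      ((ρ ^ ∣ w ∣₁) ⊙ πʷ w) ∘ τ n X                         ≈⟨ ∘-congʳ (π-tupleʷ {n} _ w) ⟨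
      (πʷ w ∘ mⁿ n ρ X) ∘ τ n X                             ≈⟨ assoc ⟩
      πʷ w ∘ (mⁿ n ρ X ∘ τ n X)                             ∎

    τ-θ : ∀ n X → τ n X ∘ θₙ n X ≈ θⁿ n X ∘ τ⋆τ n n X
    τ-θ n X = πʷ-ext n λ w → begin
      πʷ w ∘ (τ n X ∘ θₙ n X)                                      ≈⟨ πʷ-τ-∘ w (θₙ n X) ⟩
      weight w ⊙ (π {n} (ones w) ∘ θₙ n X)                         ≈⟨ ⊙-congˡ (π-tupleₙ {n} _ (ones w)) ⟩
      weight w ⊙ sum (λ (i , j) → π {n} i ∘ π {n} j) (indexSplittings (ones w))
        ≈⟨ ⊙-congˡ (sum-cong (λ (i , j) → π∘π-toℕ i j) (indexSplittings (ones w))) ⟩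
      weight w ⊙ sum (λ (i , j) → πᴺ∘πᴺ (toℕ i) (toℕ j)) (indexSplittings (ones w))
        ≈⟨ ⊙-congˡ (sum-indexSplittings (ones w) πᴺ∘πᴺ) ⟩
      weight w ⊙ antidiagonal (toℕ (ones w)) πᴺ∘πᴺ
        ≡⟨ ≡.cong (λ k → weight w ⊙ antidiagonal k πᴺ∘πᴺ) (toℕ-ones w) ⟩
      weight w ⊙ antidiagonal ∣ w ∣₁ πᴺ∘πᴺ
        -- The passage from integers to words: the weight of `w` is distributed over the splittings
        -- of `w`.
        ≈⟨ wordConvolution-weight (Hom _ X) w πᴺ∘πᴺ ⟨
      wordConvolution w (λ u v → (weight u * weight v) ⊙ πᴺ∘πᴺ ∣ u ∣₁ ∣ v ∣₁)
        ≈⟨ wordConvolution-cong w πʷ∘πʷ-τ⋆τ ⟨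
      wordConvolution w (λ u v → (πʷ u ∘ πʷ v) ∘ τ⋆τ n n X)
        ≈⟨ sum-wordSplittings w (λ u v → (πʷ u ∘ πʷ v) ∘ τ⋆τ n n X) ⟨
      sum (λ (u , v) → (πʷ u ∘ πʷ v) ∘ τ⋆τ n n X) (wordSplittings w)
        ≈⟨ sum-∘ (τ⋆τ n n X) (λ (u , v) → πʷ u ∘ πʷ v) (wordSplittings w) ⟨
      sum (λ (u , v) → πʷ u ∘ πʷ v) (wordSplittings w) ∘ τ⋆τ n n X ≈⟨ ∘-congʳ (π-tupleʷ {n} _ w) ⟨
      (πʷ w ∘ θⁿ n X) ∘ τ⋆τ n n X                                  ≈⟨ assoc ⟩
      πʷ w ∘ (θⁿ n X ∘ τ⋆τ n n X)                                  ∎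
      where
      πᴺ∘πᴺ : ℕ → ℕ → Sₙ n (Sₙ n X) ⇒ X
      πᴺ∘πᴺ i j = πᴺ n i ∘ πᴺ n j

      π∘π-toℕ : ∀ i j → π {n} i ∘ π {n} j ≈ πᴺ∘πᴺ (toℕ i) (toℕ j)
      π∘π-toℕ i j = HomSemimodule.≈ᴹ-reflexive (≡.cong₂ _∘_ (π-toℕ {n = n} i) (π-toℕ {n = n} j))

      πʷ∘πʷ-τ⋆τ : ∀ (u v : Word n) →
        (πʷ u ∘ πʷ v) ∘ τ⋆τ n n X ≈ (weight u * weight v) ⊙ πᴺ∘πᴺ ∣ u ∣₁ ∣ v ∣₁
      πʷ∘πʷ-τ⋆τ u v = begin
        (πʷ u ∘ πʷ v) ∘ τ⋆τ n n X                                       ≈⟨ πʷ-πʷ-τ⋆τ u v ⟩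
        (weight u * weight v) ⊙ (π {n} (ones u) ∘ π {n} (ones v))       ≈⟨ ⊙-congˡ (π∘π-toℕ (ones u) (ones v)) ⟩
        (weight u * weight v) ⊙ πᴺ∘πᴺ (toℕ (ones u)) (toℕ (ones v))
          ≡⟨ ≡.cong₂ (λ i j → (weight u * weight v) ⊙ πᴺ∘πᴺ i j) (toℕ-ones u) (toℕ-ones v) ⟩
        (weight u * weight v) ⊙ πᴺ∘πᴺ ∣ u ∣₁ ∣ v ∣₁                     ∎

    π-π-cₙ : ∀ {n m} (i : Fin (suc n)) (j : Fin (suc m)) →
             (π {n} i ∘ π {m} j) ∘ cₙ n m X ≈ π {m} j ∘ π {n} i
    π-π-cₙ {X = X} {n} {m} i j = begin
      (π {n} i ∘ π {m} j) ∘ cₙ n m X   ≈⟨ assoc ⟩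
      π {n} i ∘ (π {m} j ∘ cₙ n m X)   ≈⟨ ∘-congˡ (π-tupleₙ {m} _ j) ⟩
      π {n} i ∘ _                      ≈⟨ π-tupleₙ {n} _ i ⟩
      π {m} j ∘ π {n} i                ∎

    τ-c : ∀ n m X → τ⋆τ m n X ∘ cₙ n m X ≈ cⁿ n m X ∘ τ⋆τ n m X
    τ-c n m X = πʷ-ext m λ v → πʷ-ext n λ u → begin
      πʷ u ∘ (πʷ v ∘ (τ⋆τ m n X ∘ cₙ n m X))
        ≈⟨ ≈-trans (∘-congˡ (≈ᴹ-sym assoc)) (≈-trans (≈ᴹ-sym assoc) (∘-congʳ (≈ᴹ-sym assoc))) ⟩
      ((πʷ u ∘ πʷ v) ∘ τ⋆τ m n X) ∘ cₙ n m X
        ≈⟨ ∘-congʳ (πʷ-πʷ-τ⋆τ u v) ⟩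
      ((weight u * weight v) ⊙ (π {n} (ones u) ∘ π {m} (ones v))) ∘ cₙ n m X
        ≈⟨ ⊙-∘ _ _ _ ⟩
      (weight u * weight v) ⊙ ((π {n} (ones u) ∘ π {m} (ones v)) ∘ cₙ n m X)
        -- `cₙ` exchanges the projections, and commutativity of `R` exchanges the weights to match.
        ≈⟨ *ₗ-cong (CommutativeSemiring.*-comm R _ _) (π-π-cₙ (ones u) (ones v)) ⟩
      (weight v * weight u) ⊙ (π {m} (ones v) ∘ π {n} (ones u))
        ≈⟨ πʷ-πʷ-τ⋆τ v u ⟨
      (πʷ v ∘ πʷ u) ∘ τ⋆τ n m X
        ≈⟨ ∘-congʳ (π-tupleʷ {n} _ u) ⟨
      (πʷ u ∘ _) ∘ τ⋆τ n m X
        ≈⟨ ∘-congʳ (∘-congˡ (π-tupleʷ {m} _ v)) ⟨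
      (πʷ u ∘ (πʷ v ∘ cⁿ n m X)) ∘ τ⋆τ n m X
        ≈⟨ ≈-trans assoc (∘-congˡ assoc) ⟩
      πʷ u ∘ (πʷ v ∘ (cⁿ n m X ∘ τ⋆τ n m X)) ∎

-- Linear morphisms and the comparison for the tangent functors.

module Differential {R : CommutativeSemiring c r} (C : CartesianDifferentialCategory R o ℓ e) where

  open CartesianDifferentialCategory C
  open DifferentialFamilies C
  open CartesianLeftAdditive cartesianLeftAdditiveCategory
  open HomSemimodule using (≈ᴹ-sym)
  open HomReasoning

  private
    variable
      A X Y Z : Obj

  open module Derivation {X Y} = AdditiveMaps {M = Hom X Y} {N = Hom (S X) Y} (D-additive X Y)
    using () renaming (⟦⟧-cong to D-cong; *ₗ-homo to D-⊙)

  -- These are exactly the morphisms on which `mapT` and `mapS` agree.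
  IsLinear : X ⇒ Y → Set _
  IsLinear f = D f ≈ f ∘ π₁

  π₀-linear : IsLinear (π₀ {X} {Y})
  π₀-linear {X} {Y} = D-proj {1} F zero
    where
    F : Fin 2 → Obj
    F zero    = X
    F (suc _) = Y

  π₁-linear : IsLinear (π₁ {X} {Y})
  -- The product of a single factor is that factor, so the last projection unfolds to `id ∘ π₁`
  -- instead of `π₁`.
  π₁-linear {X} {Y} = ≈-trans (D-cong (≈ᴹ-sym identityˡ))
                     (≈-trans (D-proj {1} F (suc zero)) (∘-congʳ identityˡ))
    where
    F : Fin 2 → Obj
    F zero    = X
    F (suc _) = Y

  D-linear-∘ : {g : Y ⇒ Z} {f : X ⇒ Y} → IsLinear g → D (g ∘ f) ≈ g ∘ D f
  D-linear-∘ {g = g} {f} g-linear = begin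
    D (g ∘ f)                       ≈⟨ D-∘ g f ⟩
    D g ∘ ⟨ f ∘ π₀ , D f ⟩          ≈⟨ ∘-congʳ g-linear ⟩
    (g ∘ π₁) ∘ ⟨ f ∘ π₀ , D f ⟩     ≈⟨ assoc ⟩
    g ∘ (π₁ ∘ ⟨ f ∘ π₀ , D f ⟩)     ≈⟨ ∘-congˡ project₁ ⟩
    g ∘ D f                         ∎

  ∘-linear : {g : Y ⇒ Z} {f : X ⇒ Y} → IsLinear g → IsLinear f → IsLinear (g ∘ f)
  ∘-linear g-linear f-linear =
    ≈-trans (D-linear-∘ g-linear) (≈-trans (∘-congˡ f-linear) (≈ᴹ-sym assoc))

  linear-resp-≈ : {f g : X ⇒ Y} → f ≈ g → IsLinear f → IsLinear g
  linear-resp-≈ f≈g f-linear = ≈-trans (D-cong (≈ᴹ-sym f≈g)) (≈-trans f-linear (∘-congʳ f≈g))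

  -- Projections are linear, so `D` commutes with taking components and linearity can be tested on
  -- them.
  ext-linear : {h : A ⇒ X ⊗ Y} → IsLinear (π₀ ∘ h) → IsLinear (π₁ ∘ h) → IsLinear h
  ext-linear π₀h-linear π₁h-linear = ⟨⟩-ext
    (≈-trans (≈ᴹ-sym (D-linear-∘ π₀-linear)) (≈-trans π₀h-linear assoc))
    (≈-trans (≈ᴹ-sym (D-linear-∘ π₁-linear)) (≈-trans π₁h-linear assoc))

  ⟨⟩-linear : {f : A ⇒ X} {g : A ⇒ Y} → IsLinear f → IsLinear g → IsLinear ⟨ f , g ⟩
  ⟨⟩-linear f-linear g-linear = ext-linear
    (linear-resp-≈ (≈ᴹ-sym project₀) f-linear) (linear-resp-≈ (≈ᴹ-sym project₁) g-linear)

  ⊙-linear : ∀ s {f : X ⇒ Y} → IsLinear f → IsLinear (s ⊙ f)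
  ⊙-linear s {f} f-linear = ≈-trans (D-⊙ s f)
    (≈-trans (⊙-congˡ f-linear)
             (≈ᴹ-sym (AdditiveMaps.*ₗ-homo {M = Hom _ _} {N = Hom _ _} (precomposition-additive π₁ _) s f)))

  tupleₙ-linear : ∀ n {f : Fin (suc n) → A ⇒ X} → (∀ i → IsLinear (f i)) → IsLinear (tupleₙ {n} f)
  tupleₙ-linear zero    f-linear = f-linear zero
  tupleₙ-linear (suc n) f-linear = ⟨⟩-linear (f-linear zero) (tupleₙ-linear n (λ i → f-linear (suc i)))

  π-linear : ∀ n (i : Fin (suc n)) → IsLinear (π {n} {X} i)
  π-linear n i = D-proj {n} (λ _ → _) i

  mapS-linear : {f : X ⇒ Y} → IsLinear f → IsLinear (mapS f)
  mapS-linear f-linear = ⟨⟩-linear (∘-linear f-linear π₀-linear) (∘-linear f-linear π₁-linear)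

  mapSⁿ-linear : ∀ n {f : X ⇒ Y} → IsLinear f → IsLinear (mapSⁿ n f)
  mapSⁿ-linear zero    f-linear = f-linear
  mapSⁿ-linear (suc n) f-linear = mapS-linear (mapSⁿ-linear n f-linear)

  mapT-cong : {f g : X ⇒ Y} → f ≈ g → mapT f ≈ mapT g
  mapT-cong f≈g = ⟨⟩-cong (∘-congʳ f≈g) (D-cong f≈g)

  -- `mapS` preserves linearity, so each further `mapT` is applied to a linear morphism, where it
  -- agrees with `mapS`.
  mapTⁿ≈mapSⁿ : ∀ n {f : X ⇒ Y} → IsLinear f → mapTⁿ n f ≈ mapSⁿ n f
  mapTⁿ≈mapSⁿ zero    f-linear = ≈-refl
  mapTⁿ≈mapSⁿ (suc n) f-linear =
    ≈-trans (mapT-cong (mapTⁿ≈mapSⁿ n f-linear)) (⟨⟩-cong ≈-refl (mapSⁿ-linear n f-linear))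

  module _ (inv : IntegerInverses R) where

    open TangentComparison inv

    τ-linear : ∀ n X → IsLinear (τ n X)
    τ-linear zero    X = ≈-trans D-id (≈ᴹ-sym identityˡ)
    τ-linear (suc n) X = ∘-linear (mapS-linear (τ-linear n X))
      (⟨⟩-linear (tupleₙ-linear n (λ i → π-linear (suc n) (inject₁ i)))
                 (tupleₙ-linear n (λ i → ⊙-linear _ (π-linear (suc n) (suc i)))))

    τ⋆τᵀ≈τ⋆τ : ∀ n m X → τ⋆τᵀ n m X ≈ τ⋆τ n m X
    τ⋆τᵀ≈τ⋆τ n m X = ∘-congʳ (mapTⁿ≈mapSⁿ n (τ-linear m X))

proposition15 : {c r o ℓ e : Level} (R : CommutativeSemiring c r) (inv : IntegerInverses R)
    (C : CartesianDifferentialCategory R o ℓ e) →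
    let open CartesianDifferentialCategory C
        open DifferentialFamilies C
        open TangentComparison inv
    in (n m : ℕ) (ρ : CommutativeSemiring.Carrier R) (X : Obj) →
      ( τ n X ∘ ιₙ n X ≈ ιⁿ n X
      × τ n X ∘ θₙ n X ≈ θⁿ n X ∘ τ⋆τ n n X
      × τ n X ∘ mₙ n ρ X ≈ mⁿ n ρ X ∘ τ n X
      × τ⋆τ m n X ∘ cₙ n m X ≈ cⁿ n m X ∘ τ⋆τ n m X )
      ×
      ( τ n X ∘ ιₙ n X ≈ ιⁿ n X
      × τ n X ∘ θₙ n X ≈ θⁿ n X ∘ τ⋆τᵀ n n X
      × τ n X ∘ mₙ n ρ X ≈ mⁿ n ρ X ∘ τ n X
      × τ⋆τᵀ m n X ∘ cₙ n m X ≈ cⁿ n m X ∘ τ⋆τᵀ n m X )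
proposition15 R inv C n m ρ X =
    (τ-ι n X , τ-θ n X , τ-m n ρ X , τ-c n m X)
  -- Only the equations for θ and c contain a horizontal composite, so only these two need
  -- rewriting.
  , (τ-ι n X , ≈-trans (τ-θ n X) (∘-congˡ (≈ᴹ-sym (τ⋆τᵀ≈τ⋆τ inv n n X))) , τ-m n ρ X
    , ≈-trans (∘-congʳ (τ⋆τᵀ≈τ⋆τ inv m n X))
        (≈-trans (τ-c n m X) (∘-congˡ (≈ᴹ-sym (τ⋆τᵀ≈τ⋆τ inv n m X)))))
  where
  open CartesianDifferentialCategory C
  open CartesianLeftAdditive cartesianLeftAdditiveCategory
  open Comparisons inv
  open Differential C
  open HomSemimodule using (≈ᴹ-sym)
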